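{- Let $k\ge 2$ and $n$ be integers with $2k\le n\le k^2$. Then $$m(n,k,1)=k\binom{n-1}{k}.$$
   Context: For integers $n\ge k+1$, let $\mathcal V(n,k,1)\subset\mathbb R^n$ be the set of all vectors with coordinates in $\{0,1,-1\}$ having exactly $k$ coordinates equal to $+1$ and exactly one coordinate equal to $-1$ (all other coordinates $0$). For $n\ge 2k$ the minimum possible scalar product of two vectors in $\mathcal V(n,k,1)$ is $-2$. A family $\mathcal V\subset\mathcal V(n,k,1)$ is called intersecting if $\langle v,w\rangle>-2$ for all $v,w\in\mathcal V$. Let $m(n,k,1)$ be the maximum of $|\mathcal V|$ over all intersecting families $\mathcal V\subset\mathcal V(n,k,1)$. -}

module Defs where

open import Data.Nat.Base as ℕ using (ℕ)
open import Data.Integer.Base using (ℤ; 0ℤ; 1ℤ; -1ℤ; -[1+_]; _+_; _*_; _>_)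
open import Data.Integer.Properties using (_≟_)
open import Data.List.Base using (List; length)
open import Data.List.Membership.Propositional using (_∈_)
import Data.List.Relation.Unary.All as List
open import Data.List.Relation.Unary.Unique.Propositional using (Unique)
open import Data.Product.Base using (_×_; ∃-syntax)
open import Data.Sum.Base using (_⊎_)
open import Data.Vec.Base using (Vec; count; foldr′; zipWith)
import Data.Vec.Relation.Unary.All as Vec
open import Relation.Binary.PropositionalEquality.Core using (_≡_)

⟨_,_⟩ : ∀ {n} → Vec ℤ n → Vec ℤ n → ℤ
⟨ v , w ⟩ = foldr′ _+_ 0ℤ (zipWith _*_ v w)

-- The set 𝒱(n,k,1).  All coordinates lie in {0, 1, -1}, so ℤⁿ serves as the
-- ambient space in place of ℝⁿ.
record 𝒱₁ (n k : ℕ) (v : Vec ℤ n) : Set where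
  field
    coordinates : Vec.All (λ x → x ≡ 0ℤ ⊎ x ≡ 1ℤ ⊎ x ≡ -1ℤ) v
    plusOnes    : count (_≟ 1ℤ) v ≡ k
    minusOnes   : count (_≟ -1ℤ) v ≡ 1

-- A finite subset of 𝒱(n,k,1) is listed without repetition, so that its
-- cardinality is the length of the list.
record IsIntersectingFamily (n k : ℕ) (F : List (Vec ℤ n)) : Set where
  field
    distinct     : Unique F
    members      : List.All (𝒱₁ n k) F
    -- v and w may coincide; -[1+ 1 ] is the integer -2.
    intersecting : ∀ {v w} → v ∈ F → w ∈ F → ⟨ v , w ⟩ > -[1+ 1 ]

IsMaximum : (ℕ → Set) → ℕ → Set
IsMaximum P m = P m × (∀ s → P s → s ℕ.≤ m)

-- The graph of m: m(n,k,1) = s as a relation between n, k and s.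
m[_,_,1]≡_ : ℕ → ℕ → ℕ → Set
m[ n , k ,1]≡ s =
  IsMaximum (λ c → ∃[ F ] IsIntersectingFamily n k F × length F ≡ c) s

{-# OPTIONS --safe #-}
module Submission where

-- For the upper bound, shift the family: whenever v i > v j for some i < j, replace v by its
-- transposition unless that is already present.  This keeps the size and the absence of
-- products -2, so the family may be assumed closed under such transpositions.  Split it by
-- the first coordinate.  The part with 0 there is handled by induction on n.  The parts A
-- (first entry -1) and B (first entry +1) lose their first coordinate; by shiftedness, no
-- v in A ∪ B and w in B have disjoint sets of +1's with the -1 of w in the support of v,
-- and the support of each vector of B is in A.  Such "cross" conditions pass to slices, and
-- induction gives |B| ≤ (k - 1) C(n - 2, k - 1) together with a linear inequality
-- k (k - 1) |A| + (n - 1 - k) |B| ≤ k (k - 1) C(n - 1, k).  For n ≤ k² these two imply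
-- |A| + |B| ≤ k C(n - 2, k - 1).  In the inductions the essential base case is a pair of families
-- of complementary sizes, where splitting by the first coordinate needs no shifting.
-- The vectors with +1 in the first coordinate attain the bound.

open import Defs
open import Data.Nat.Base using (ℕ; _≤_; _*_; _∸_; _^_; zero; suc; _+_; _<_; _≡ᵇ_; z≤n; s≤s; s≤s⁻¹)
open import Data.Nat.Combinatorics using (_C_; nCk≡nC[n∸k]; nCn≡1; nCk+nC[k+1]≡[n+1]C[k+1])
open import Data.Nat.Properties
open import Data.Nat.Induction using (<-wellFounded)
open import Data.Nat.Tactic.RingSolver using (solve-∀)
open import Data.Bool.Base using (Bool; true; false; T; _∧_; _∨_; if_then_else_)
open import Data.Bool.Properties using (T?; T-∨)
open import Data.Empty using (⊥; ⊥-elim)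
open import Data.Unit.Base using (tt)
open import Data.Fin.Base using (Fin; zero; suc)
import Data.Fin.Properties as Fin
open import Data.Integer.Base as ℤ using (ℤ; 0ℤ; 1ℤ; -1ℤ; -[1+_])
import Data.Integer.Properties as ℤ
open import Data.List.Base as List using (List; []; _∷_; _++_; length)
open import Data.List.Properties using (length-++; length-map)
open import Data.List.Membership.Propositional using (_∈_)
import Data.List.Membership.DecPropositional as DecMembership
open import Data.List.Membership.Propositional.Properties using (∈-map⁻; ∈-++⁻)
open import Data.List.Relation.Binary.Disjoint.Propositional using (Disjoint)
open import Data.List.Relation.Unary.All as All using (All; []; _∷_)
import Data.List.Relation.Unary.All.Properties as All
open import Data.List.Relation.Unary.All.Properties.Core using (All¬⇒¬Any)
open import Data.List.Relation.Unary.Any using (here; there)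
open import Data.List.Relation.Unary.Unique.Propositional using (Unique; []; _∷_)
import Data.List.Relation.Unary.Unique.Propositional.Properties as Unique
open import Data.Product.Base using (_×_; _,_; ∃-syntax; ∃)
open import Data.Sum.Base using (_⊎_; inj₁; inj₂)
open import Data.Vec.Base as Vec using (Vec; []; _∷_; lookup; _[_]≔_; count)
import Data.Vec.Properties as Vec
open import Data.Vec.Properties using (lookup∘updateAt; []≔-idempotent; []≔-lookup)
open import Data.Vec.Relation.Binary.Pointwise.Inductive as Pointwise using (Pointwise; []; _∷_)
import Data.Vec.Relation.Unary.All as VecAll
open import Function.Base using (_∘_; id)
open import Function.Bundles using (Equivalence)
open import Induction.WellFounded using (Acc; acc)
open import Relation.Nullary using (¬_; Dec; yes; no)
open import Relation.Nullary.Decidable using (map′; _⊎-dec_; isYes; toWitness)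
open import Relation.Binary.PropositionalEquality

private variable
  n p q e s : ℕ

-- Families of vectors over -1, 0, 1, and sums over all such vectors.

data Trit : Set where
  neg nil pos : Trit

-- As Boolean predicates, families have slices by mere composition, and membership in a shifted
-- family is a Boolean expression.
Family : ℕ → Set
Family n = Vec Trit n → Bool

slice : {A : Set} → Trit → (Vec Trit (suc n) → A) → Vec Trit n → A
slice a f v = f (a ∷ v)

∑ : (Vec Trit n → ℕ) → ℕ
∑ {zero}  f = f []
∑ {suc n} f = ∑ (slice neg f) + ∑ (slice nil f) + ∑ (slice pos f)

∑-mono : (f g : Vec Trit n → ℕ) → (∀ v → f v ≤ g v) → ∑ f ≤ ∑ g
∑-mono {zero}  f g h = h []
∑-mono {suc n} f g h = +-mono-≤ (+-mono-≤ (on neg) (on nil)) (on pos)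
  where
  on : ∀ a → ∑ (slice a f) ≤ ∑ (slice a g)
  on a = ∑-mono (slice a f) (slice a g) (h ∘ (a ∷_))

∑-mono-< : (f g : Vec Trit n → ℕ) → (∀ v → f v ≤ g v) → ∀ v → f v < g v → ∑ f < ∑ g
∑-mono-< f g h []      lt = lt
∑-mono-< f g h (a ∷ v) lt = at a (∑-mono-< (slice a f) (slice a g) (h ∘ (a ∷_)) v lt)
  where
  on : ∀ a → ∑ (slice a f) ≤ ∑ (slice a g)
  on a = ∑-mono (slice a f) (slice a g) (h ∘ (a ∷_))
  at : ∀ a → ∑ (slice a f) < ∑ (slice a g) → ∑ f < ∑ g
  at neg lt = +-mono-<-≤ (+-mono-<-≤ lt (on nil)) (on pos)
  at nil lt = +-mono-<-≤ (+-mono-≤-< (on neg) lt) (on pos)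
  at pos lt = +-mono-≤-< (+-mono-≤ (on neg) (on nil)) lt

∑-tail : (f g : Vec Trit (suc n) → ℕ) → (∀ a → ∑ (slice a f) ≡ ∑ (slice a g)) → ∑ f ≡ ∑ g
∑-tail f g h = cong₂ _+_ (cong₂ _+_ (h neg) (h nil)) (h pos)

∑-distrib-+ : (f g : Vec Trit n → ℕ) → ∑ (λ v → f v + g v) ≡ ∑ f + ∑ g
∑-distrib-+ {zero}  f g = refl
∑-distrib-+ {suc n} f g =
  trans (cong₂ _+_ (cong₂ _+_ (on neg) (on nil)) (on pos))
        (regroup (∑ (slice neg f)) (∑ (slice neg g)) (∑ (slice nil f)) (∑ (slice nil g))
                 (∑ (slice pos f)) (∑ (slice pos g)))
  where
  on : ∀ a → ∑ (λ v → slice a f v + slice a g v) ≡ ∑ (slice a f) + ∑ (slice a g)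
  on a = ∑-distrib-+ (slice a f) (slice a g)
  regroup : ∀ a b c d x y → a + b + (c + d) + (x + y) ≡ a + c + x + (b + d + y)
  regroup = solve-∀

weigh : Bool → ℕ → ℕ
weigh b x = if b then x else 0

# : Family n → ℕ
# F = ∑ λ v → weigh (F v) 1

#-empty : (F : Family n) → (∀ {v} → ¬ T (F v)) → # F ≡ 0
#-empty {zero} F h with F [] | h {[]}
... | false | _ = refl
... | true  | ¬t = ⊥-elim (¬t tt)
#-empty {suc n} F h = cong₂ _+_ (cong₂ _+_ (on neg) (on nil)) (on pos)
  where
  on : ∀ a → # (slice a F) ≡ 0
  on a = #-empty (slice a F) h

-- Pointwise Opposed v w says that ⟨ v , w ⟩ = -2 when v and w have one -1 each.
data Opposed : Trit → Trit → Set where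
  nn : Opposed nil nil
  np : Opposed nil pos
  pn : Opposed pos nil
  pm : Opposed pos neg
  mp : Opposed neg pos

-- Weaker than Opposed in that the entries opposite a -1 of the left vector are free; for
-- shifted families avoiding it is inherited by slices (cross-pos).
data Against : Trit → Trit → Set where
  nn : Against nil nil
  np : Against nil pos
  pn : Against pos nil
  pm : Against pos neg
  mp : Against neg pos
  mn : Against neg nil
  mm : Against neg neg

Avoid : (Trit → Trit → Set) → Family n → Family n → Set
Avoid R X Y = ∀ {v w} → T (X v) → T (Y w) → ¬ Pointwise R v w

Cross : Family n → Family n → Set
Cross = Avoid Against

avoid-slice : ∀ {R a b} {X Y : Family (suc n)} → R a b → Avoid R X Y → Avoid R (slice a X) (slice b Y)
avoid-slice ab h x y vw = h x y (ab ∷ vw)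

data Has : ℕ → ℕ → Vec Trit n → Set where
  []  : Has 0 0 []
  neg : ∀ {v : Vec Trit n} → Has p e v → Has p (suc e) (neg ∷ v)
  nil : ∀ {v : Vec Trit n} → Has p e v → Has p e (nil ∷ v)
  pos : ∀ {v : Vec Trit n} → Has p e v → Has (suc p) e (pos ∷ v)

Typed : ℕ → ℕ → Family n → Set
Typed p e F = ∀ {v} → T (F v) → Has p e v

typed-neg : {F : Family (suc n)} → Typed p (suc e) F → Typed p e (slice neg F)
typed-neg h x with h x
... | neg y = y

typed-nil : {F : Family (suc n)} → Typed p e F → Typed p e (slice nil F)
typed-nil h x with h x
... | nil y = y

typed-pos : {F : Family (suc n)} → Typed (suc p) e F → Typed p e (slice pos F)
typed-pos h x with h x
... | pos y = y

no-neg : (F : Family (suc n)) → Typed p 0 F → # (slice neg F) ≡ 0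
no-neg F h = #-empty (slice neg F) go
  where
  go : ∀ {v} → ¬ T (F (neg ∷ v))
  go x with h x
  ... | ()

no-pos : (F : Family (suc n)) → Typed 0 e F → # (slice pos F) ≡ 0
no-pos F h = #-empty (slice pos F) go
  where
  go : ∀ {v} → ¬ T (F (pos ∷ v))
  go x with h x
  ... | ()

has-bound : {v : Vec Trit n} → Has p e v → p + e ≤ n
has-bound []      = z≤n
has-bound {p = p} (neg h) = ≤-trans (≤-reflexive (+-suc p _)) (s≤s (has-bound h))
has-bound (nil h) = m≤n⇒m≤1+n (has-bound h)
has-bound (pos h) = s≤s (has-bound h)

too-long : (F : Family n) → Typed p e F → n < p + e → # F ≡ 0
too-long F h n<p+e = #-empty F λ x → <⇒≱ n<p+e (has-bound (h x))

no-large-sets : (F : Family n) → Typed p 0 F → n < p → # F ≡ 0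
no-large-sets F t n<p = too-long F t (≤-trans n<p (m≤m+n _ 0))

no-full-support : (F : Family n) → Typed n 1 F → # F ≡ 0
no-full-support {n} F t = too-long F t (m<m+n n (s≤s z≤n))

-- Shifting

-- Positions i < j, with `later` skipping a common leading entry. A `later` pair acts inside each
-- slice, which makes `shifted-slice` immediate.
data Pair : ℕ → Set where
  first : Fin n → Pair (suc n)
  later : Pair n → Pair (suc n)

search : {Q : Pair n → Set} → (∀ π → Dec (Q π)) → Dec (∃ Q)
search {zero}  Q? = no λ { (() , _) }
search {suc n} Q? =
  map′ (λ { (inj₁ (i , x)) → first i , x ; (inj₂ (π , x)) → later π , x })
       (λ { (first i , x) → inj₁ (i , x) ; (later π , x) → inj₂ (π , x) })
       (Fin.any? (Q? ∘ first) ⊎-dec search (Q? ∘ later))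

swap : Pair n → Vec Trit n → Vec Trit n
swap (first i) (a ∷ v) = lookup v i ∷ v [ i ]≔ a
swap (later π) (a ∷ v) = a ∷ swap π v

data Order : Set where
  asc same desc : Order

compare : Trit → Trit → Order
compare neg neg = same
compare neg nil = asc
compare neg pos = asc
compare nil neg = desc
compare nil nil = same
compare nil pos = asc
compare pos neg = desc
compare pos nil = desc
compare pos pos = same

order : Pair n → Vec Trit n → Order
order (first i) (a ∷ v) = compare a (lookup v i)
order (later π) (a ∷ v) = order π v

reverse : Order → Order
reverse asc  = desc
reverse same = same
reverse desc = asc

compare-reverse : ∀ a b → compare b a ≡ reverse (compare a b)
compare-reverse neg neg = refl
compare-reverse neg nil = refl
compare-reverse neg pos = refl
compare-reverse nil neg = refl
compare-reverse nil nil = refl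
compare-reverse nil pos = refl
compare-reverse pos neg = refl
compare-reverse pos nil = refl
compare-reverse pos pos = refl

compare-same : ∀ a b → compare a b ≡ same → a ≡ b
compare-same neg neg _ = refl
compare-same nil nil _ = refl
compare-same pos pos _ = refl

order-swap : ∀ (π : Pair n) v → order π (swap π v) ≡ reverse (order π v)
order-swap (first i) (a ∷ v) =
  trans (cong (compare (lookup v i)) (lookup∘updateAt i v)) (compare-reverse a (lookup v i))
order-swap (later π) (a ∷ v) = order-swap π v

swap-same : ∀ (π : Pair n) v → order π v ≡ same → swap π v ≡ v
swap-same (first i) (a ∷ v) eq with compare-same a (lookup v i) eq
... | refl = cong (lookup v i ∷_) ([]≔-lookup v i)
swap-same (later π) (a ∷ v) eq = cong (a ∷_) (swap-same π v eq)

swap-involutive : ∀ (π : Pair n) v → swap π (swap π v) ≡ v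
swap-involutive (first i) (a ∷ v) =
  cong₂ _∷_ (lookup∘updateAt i v) (trans ([]≔-idempotent v i) ([]≔-lookup v i))
swap-involutive (later π) (a ∷ v) = cong (a ∷_) (swap-involutive π v)

has-swap₂ : ∀ {a b} {v : Vec Trit n} → Has p e (a ∷ b ∷ v) → Has p e (b ∷ a ∷ v)
has-swap₂ (neg (neg h)) = neg (neg h)
has-swap₂ (neg (nil h)) = nil (neg h)
has-swap₂ (neg (pos h)) = pos (neg h)
has-swap₂ (nil (neg h)) = neg (nil h)
has-swap₂ (nil (nil h)) = nil (nil h)
has-swap₂ (nil (pos h)) = pos (nil h)
has-swap₂ (pos (neg h)) = neg (pos h)
has-swap₂ (pos (nil h)) = nil (pos h)
has-swap₂ (pos (pos h)) = pos (pos h)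

has-tail : ∀ {a} {v w : Vec Trit n} → (∀ {p e} → Has p e v → Has p e w) →
           Has p e (a ∷ v) → Has p e (a ∷ w)
has-tail f (neg h) = neg (f h)
has-tail f (nil h) = nil (f h)
has-tail f (pos h) = pos (f h)

-- Exchanging positions 0 and 1 conjugates a transposition of position 0 with a position beyond 1
-- into one that acts on the tail. `∑-swap` uses the same reduction.
has-swap : ∀ (π : Pair n) {v} → Has p e v → Has p e (swap π v)
has-swap (first zero)    {a ∷ b ∷ v} h = has-swap₂ h
has-swap (first (suc i)) {a ∷ b ∷ v} h =
  has-swap₂ (has-tail (has-swap (first i)) (has-swap₂ h))
has-swap (later π)       {a ∷ v} h = has-tail (has-swap π) h

∑-exchange : (f : Trit → Trit → Vec Trit n → ℕ) →
  ∑ {suc (suc n)} (λ { (a ∷ b ∷ v) → f a b v }) ≡ ∑ {suc (suc n)} (λ { (a ∷ b ∷ v) → f b a v })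
∑-exchange f =
  transpose (∑ (f neg neg)) (∑ (f neg nil)) (∑ (f neg pos))
            (∑ (f nil neg)) (∑ (f nil nil)) (∑ (f nil pos))
            (∑ (f pos neg)) (∑ (f pos nil)) (∑ (f pos pos))
  where
  transpose : ∀ a b c d e f g h i →
    a + b + c + (d + e + f) + (g + h + i) ≡ a + d + g + (b + e + h) + (c + f + i)
  transpose = solve-∀

∑-swap : ∀ (π : Pair n) f → ∑ (f ∘ swap π) ≡ ∑ f
∑-swap {suc (suc n)} (first zero)    f = ∑-exchange λ a b v → f (b ∷ a ∷ v)
∑-swap {suc (suc n)} (first (suc i)) f =
  trans (∑-exchange λ a b v → f (lookup v i ∷ b ∷ v [ i ]≔ a))
 (trans (∑-tail {suc n} (λ { (b ∷ a ∷ v) → f (lookup v i ∷ b ∷ v [ i ]≔ a) }) (λ { (b ∷ a ∷ v) → f (a ∷ b ∷ v) })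
          λ b → ∑-swap (first i) (λ { (a ∷ v) → f (a ∷ b ∷ v) }))
        (∑-exchange λ b a v → f (a ∷ b ∷ v)))
∑-swap (later π) f = ∑-tail (f ∘ swap (later π)) f λ a → ∑-swap π (slice a f)

combine : Order → Bool → Bool → Bool
combine asc  b c = b ∨ c
combine same b c = b
combine desc b c = b ∧ c

-- Of two distinct vectors exchanged by `π`, the ascent is in the result if either was in `F`, the
-- descent only if both were. So all descents whose swap is missing are replaced at once.
shift : Pair n → Family n → Family n
shift π F v = combine (order π v) (F v) (F (swap π v))

Shifted : Family n → Set
Shifted F = ∀ π {v} → order π v ≡ desc → T (F v) → T (F (swap π v))

shifted-slice : ∀ a {F : Family (suc n)} → Shifted F → Shifted (slice a F)
shifted-slice a h π = h (later π)

shift-swap : ∀ (π : Pair n) F v →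
  shift π F (swap π v) ≡ combine (reverse (order π v)) (F (swap π v)) (F v)
shift-swap π F v =
  cong₂ (λ o w → combine o (F (swap π v)) (F w)) (order-swap π v) (swap-involutive π v)

-- Doubling the sum allows `v` and `swap π v` to be compared together, without choosing orbit
-- representatives or treating fixed vectors apart.
∑-pair : ∀ (π : Pair n) f → ∑ (λ v → f v + f (swap π v)) ≡ ∑ f + ∑ f
∑-pair π f = trans (∑-distrib-+ f (f ∘ swap π)) (cong (∑ f +_) (∑-swap π f))

∑-pair-mono : ∀ (π : Pair n) f g →
  (∀ v → f v + f (swap π v) ≤ g v + g (swap π v)) → ∑ f ≤ ∑ g
∑-pair-mono π f g h = ≮⇒≥ λ g<f → <⇒≱ (+-mono-< g<f g<f)
  (subst₂ _≤_ (∑-pair π f) (∑-pair π g) (∑-mono _ _ h))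

∑-pair-mono-< : ∀ (π : Pair n) f g →
  (∀ v → f v + f (swap π v) ≤ g v + g (swap π v)) →
  ∀ v → f v + f (swap π v) < g v + g (swap π v) → ∑ f < ∑ g
∑-pair-mono-< π f g h v lt = ≰⇒> λ g≤f → <⇒≱
  (subst₂ _<_ (∑-pair π f) (∑-pair π g) (∑-mono-< _ _ h v lt)) (+-mono-≤ g≤f g≤f)

#-shift : ∀ (π : Pair n) F → # F ≤ # (shift π F)
#-shift π F = ∑-pair-mono π _ _ λ v → ≤-trans (go (order π v) (F v) (F (swap π v)))
  (≤-reflexive (cong (λ b → weigh (shift π F v) 1 + weigh b 1) (sym (shift-swap π F v))))
  where
  go : ∀ o b c → weigh b 1 + weigh c 1 ≤ weigh (combine o b c) 1 + weigh (combine (reverse o) c b) 1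
  go asc  false false = ≤-refl
  go asc  false true  = ≤-refl
  go asc  true  false = ≤-refl
  go asc  true  true  = ≤-refl
  go same b     c     = ≤-refl
  go desc false false = ≤-refl
  go desc false true  = ≤-refl
  go desc true  false = ≤-refl
  go desc true  true  = ≤-refl

-- Reading v as a number in base 3 makes its first entry the most significant one, so
-- that swapping a descent lowers it.
value : Trit → ℕ
value neg = 0
value nil = 1
value pos = 2

rank : Vec Trit n → ℕ
rank []              = 0
rank {suc n} (a ∷ v) = value a * 3 ^ n + rank v

rank-bound : (v : Vec Trit n) → rank v < 3 ^ n
rank-bound []              = s≤s z≤n
rank-bound {suc n} (a ∷ v) =
  <-≤-trans (+-monoʳ-< (value a * 3 ^ n) (rank-bound v))
 (≤-trans (≤-reflexive (+-comm (value a * 3 ^ n) (3 ^ n))) (*-monoˡ-≤ (3 ^ n) (bound a)))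
  where
  bound : ∀ a → suc (value a) ≤ 3
  bound neg = s≤s z≤n
  bound nil = s≤s (s≤s z≤n)
  bound pos = ≤-refl

rank-head : ∀ a b (v w : Vec Trit n) → value b < value a → rank (b ∷ w) < rank (a ∷ v)
rank-head {n} a b v w b<a =
  <-≤-trans (+-monoʳ-< (value b * 3 ^ n) (rank-bound w))
 (≤-trans (≤-reflexive (+-comm (value b * 3 ^ n) (3 ^ n)))
 (≤-trans (*-monoˡ-≤ (3 ^ n) b<a) (m≤m+n _ (rank v))))

rank-swap : ∀ (π : Pair n) v → order π v ≡ desc → rank (swap π v) < rank v
rank-swap (first i) (a ∷ v) eq = rank-head a (lookup v i) v (v [ i ]≔ a) (smaller a (lookup v i) eq)
  where
  smaller : ∀ a b → compare a b ≡ desc → value b < value a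
  smaller nil neg _ = s≤s z≤n
  smaller pos neg _ = s≤s z≤n
  smaller pos nil _ = s≤s (s≤s z≤n)
  smaller neg pos ()
  smaller nil pos ()
  smaller pos pos ()
rank-swap {suc n} (later π) (a ∷ v) eq = +-monoʳ-< (value a * 3 ^ n) (rank-swap π v eq)

rank-swap-asc : ∀ (π : Pair n) v → order π v ≡ asc → rank v < rank (swap π v)
rank-swap-asc π v eq = subst (λ w → rank w < rank (swap π v)) (swap-involutive π v)
  (rank-swap π (swap π v) (trans (order-swap π v) (cong reverse eq)))

-- A shift that changes the family trades descents for their swaps, which have lower rank. This sum
-- then drops, so it serves as the termination measure in `shifting`.
potential : Family n → ℕ
potential F = ∑ λ v → weigh (F v) (rank v)

combine-≤ : ∀ o b c {x y} → (o ≡ asc → x < y) → (o ≡ desc → y < x) →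
  weigh (combine o b c) x + weigh (combine (reverse o) c b) y ≤ weigh b x + weigh c y
combine-≤ asc  false false _ _ = ≤-refl
combine-≤ asc  false true {x} lt _ = ≤-trans (≤-reflexive (+-identityʳ x)) (<⇒≤ (lt refl))
combine-≤ asc  true  false _ _ = ≤-refl
combine-≤ asc  true  true  _ _ = ≤-refl
combine-≤ same _     _     _ _ = ≤-refl
combine-≤ desc false false _ _ = ≤-refl
combine-≤ desc false true  _ _ = ≤-refl
combine-≤ desc true  false {x} _ lt = ≤-trans (<⇒≤ (lt refl)) (≤-reflexive (sym (+-identityʳ x)))
combine-≤ desc true  true  _ _ = ≤-refl

potential-pair : ∀ (π : Pair n) F v →
  weigh (shift π F v) (rank v) + weigh (shift π F (swap π v)) (rank (swap π v)) ≤
  weigh (F v) (rank v) + weigh (F (swap π v)) (rank (swap π v))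
potential-pair π F v rewrite shift-swap π F v =
  combine-≤ (order π v) (F v) (F (swap π v)) (rank-swap-asc π v) (rank-swap π v)

potential-shift : ∀ (π : Pair n) F {v} → order π v ≡ desc → T (F v) → ¬ T (F (swap π v)) →
  potential (shift π F) < potential F
potential-shift π F {v} eq x ¬y =
  ∑-pair-mono-< π _ _ (potential-pair π F) v strict
  where
  strict : weigh (shift π F v) (rank v) + weigh (shift π F (swap π v)) (rank (swap π v)) <
           weigh (F v) (rank v) + weigh (F (swap π v)) (rank (swap π v))
  strict rewrite shift-swap π F v | eq with F v | F (swap π v)
  ... | true  | false = ≤-trans (rank-swap π v eq) (≤-reflexive (sym (+-identityʳ (rank v))))
  ... | true  | true  = ⊥-elim (¬y tt)
  ... | false | _     = ⊥-elim x

-- Shift as long as some transposition lowers the potential. When none does, every descent in the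
-- family has its swap there too, by `potential-shift`.
shifting : (P : Family n → Set) → (∀ π {F} → P F → P (shift π F)) →
  ∀ {F} → P F → ∃[ G ] P G × Shifted G × # F ≤ # G
shifting P closed {F} = go F (<-wellFounded (potential F))
  where
  go : ∀ F → Acc _<_ (potential F) → P F → ∃[ G ] P G × Shifted G × # F ≤ # G
  go F (acc rec) pF with search (λ π → potential (shift π F) <? potential F)
  ... | yes (π , lt) with go (shift π F) (rec lt) (closed π pF)
  ...   | G , pG , shG , le = G , pG , shG , ≤-trans (#-shift π F) le
  go F (acc rec) pF | no none = F , pF , shifted , ≤-refl
    where
    shifted : Shifted F
    shifted π {v} eq x with T? (F (swap π v))
    ... | yes y = y
    ... | no ¬y = ⊥-elim (none (π , potential-shift π F eq x ¬y))

-- Shifting preserves the type and the absence of opposed pairs.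

typed-shift : ∀ (π : Pair n) {F} → Typed p e F → Typed p e (shift π F)
typed-shift π {F} h {v} x with order π v | F v in eq | F (swap π v) in eq′
... | asc  | true  | _     = h (subst T (sym eq) tt)
... | asc  | false | true  =
  subst (Has _ _) (swap-involutive π v) (has-swap π (h (subst T (sym eq′) tt)))
... | same | true  | _     = h (subst T (sym eq) tt)
... | desc | true  | true  = h (subst T (sym eq) tt)

pointwise-update : ∀ {R : Trit → Trit → Set} {v w : Vec Trit n} i {a b} → R a b → Pointwise R v w →
  Pointwise R (v [ i ]≔ a) (w [ i ]≔ b)
pointwise-update zero    ab (_ ∷ vw)  = ab ∷ vw
pointwise-update (suc i) ab (cd ∷ vw) = cd ∷ pointwise-update i ab vw

pointwise-swap : ∀ {R : Trit → Trit → Set} (π : Pair n) {v w} → Pointwise R v w → Pointwise R (swap π v) (swap π w)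
pointwise-swap (first i) (ab ∷ vw) = Pointwise.lookup vw i ∷ pointwise-update i ab vw
pointwise-swap (later π) (ab ∷ vw) = ab ∷ pointwise-swap π vw

-- This is why shift cannot create a product -2: a vector outside F enters it only as an ascent.
no-ascents : ∀ (π : Pair n) {v w} → Pointwise Opposed v w → order π v ≡ asc → order π w ≡ asc → ⊥
no-ascents (first i) (ab ∷ vw) = go ab (Pointwise.lookup vw i)
  where
  go : ∀ {a b c d} → Opposed a b → Opposed c d → compare a c ≡ asc → compare b d ≡ asc → ⊥
  go nn pn _ ()
  go nn pm _ ()
  go np np () _
  go np pn _ ()
  go np pm _ ()
  go mp nn _ ()
  go mp np _ ()
  go mp pn _ ()
  go mp pm _ ()
  go nn mp () _
  go np mp () _
  go pn mp () _
  go pm mp () _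
  go mp mp () _
no-ascents (later π) (_ ∷ vw) = no-ascents π vw

shift-view : ∀ (π : Pair n) {F v} → T (shift π F v) →
  (T (F v) × T (F (swap π v))) ⊎ (order π v ≡ asc × (T (F v) ⊎ T (F (swap π v))))
shift-view π {F} {v} x with order π v in eq
... | asc  = inj₂ (refl , Equivalence.to (T-∨ {F v}) x)
... | same = inj₁ (x , subst (T ∘ F) (sym (swap-same π v eq)) x)
... | desc with F v | F (swap π v)
...   | true | true = inj₁ (tt , tt)

-- If one of the vectors lies in `F` together with its swap, it can follow the other: an opposed
-- pair inside `F` arises either from `v` and `w` or from both swaps. Otherwise both are ascents,
-- and `no-ascents` applies.
avoid-shift : ∀ (π : Pair n) {F} → Avoid Opposed F F → Avoid Opposed (shift π F) (shift π F)
avoid-shift π {F} h {v} {w} x y vw with shift-view π {F} {v} x | shift-view π {F} {w} y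
... | inj₁ (x₁ , x₂)      | inj₁ (y₁ , y₂)      = h x₁ y₁ vw
... | inj₁ (x₁ , x₂)      | inj₂ (_ , inj₁ y₁)  = h x₁ y₁ vw
... | inj₁ (x₁ , x₂)      | inj₂ (_ , inj₂ y₂)  = h x₂ y₂ (pointwise-swap π vw)
... | inj₂ (_ , inj₁ x₁)  | inj₁ (y₁ , y₂)      = h x₁ y₁ vw
... | inj₂ (_ , inj₂ x₂)  | inj₁ (y₁ , y₂)      = h x₂ y₂ (pointwise-swap π vw)
... | inj₂ (asc-v , _)    | inj₂ (asc-w , _)    = no-ascents π vw asc-v asc-w

-- Counting

-- At most `p + q + e` positions hold a +1 of `v`, a +1 of `w` or a -1 of `v`, so some position has
-- 0 in both. A 0 of `w` opposite a -1 of `v` serves as well, if it comes earlier.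
against-room : ∀ {v w : Vec Trit n} → Pointwise Against v w → Has p e v → Has q s w →
  p + q + e < n → ∃[ i ] lookup w i ≡ nil × Pointwise Against v (w [ i ]≔ pos)
against-room (nn ∷ vw) _ _ _ = zero , refl , np ∷ vw
against-room (mn ∷ vw) _ _ _ = zero , refl , mp ∷ vw
against-room {n = suc n} {p = p} {e} (np ∷ vw) (nil hv) (pos {p = q} hw) lt
  with i , eq , vw′ ← against-room vw hv hw (s≤s⁻¹ (subst (_< suc n) (cong (_+ e) (+-suc p q)) lt))
  = suc i , eq , np ∷ vw′
against-room (pn ∷ vw) (pos hv) (nil hw) lt
  with i , eq , vw′ ← against-room vw hv hw (s≤s⁻¹ lt)
  = suc i , eq , pn ∷ vw′
against-room (pm ∷ vw) (pos hv) (neg hw) lt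
  with i , eq , vw′ ← against-room vw hv hw (s≤s⁻¹ lt)
  = suc i , eq , pm ∷ vw′
against-room {n = suc n} {p = p} (mp ∷ vw) (neg {e = e} hv) (pos {p = q} hw) lt
  with i , eq , vw′ ← against-room vw hv hw
    (s≤s⁻¹ (≤-trans (s≤s (+-mono-≤ (≤-reflexive (sym (+-suc p q))) (n≤1+n e))) lt))
  = suc i , eq , mp ∷ vw′
against-room {n = suc n} {p = p} {q = q} (mm ∷ vw) (neg {e = e} hv) (neg hw) lt
  with i , eq , vw′ ← against-room vw hv hw (s≤s⁻¹ (subst (_< suc n) (+-suc (p + q) e) lt))
  = suc i , eq , mm ∷ vw′

-- A leading +1 of w can be moved to a position where w is 0 and v is not +1.
cross-pos : (X Y : Family (suc n)) → Shifted Y → Cross X Y →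
  Typed p e (slice pos X) → Typed q s (slice pos Y) → p + q + e < n →
  Cross (slice pos X) (slice pos Y)
cross-pos X Y sh h tX tY lt {v} {w} x y vw
  with i , eq , vw′ ← against-room vw (tX x) (tY y) lt
  = h x (subst (λ a → T (Y (a ∷ w [ i ]≔ pos))) eq (sh (first i) (cong (compare pos) eq) y)) (pn ∷ vw′)

-- If `v` has a single -1, the updated vector is the support of `v`. For the slices of a shifted
-- family this comes from exchanging the leading +1 with that -1.
Covers : Family n → Family n → Set
Covers A B = ∀ i {v} → T (B v) → lookup v i ≡ neg → T (A (v [ i ]≔ pos))

room₀ : ∀ {x y} → p ≤ x → q < y → n ≡ x + y → p + q + 0 < n
room₀ {p} {q} {x = x} {y} p≤x q<y refl = subst (_< x + y) (sym (+-identityʳ (p + q))) (+-mono-≤-< p≤x q<y)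

room₁ : ∀ {x y} → p ≤ x → suc q < y → n ≡ x + y → p + q + 1 < n
room₁ {p} {q} {x = x} {y} p≤x q<y refl = subst (_< x + y) (trans (+-suc p q) (+-comm 1 (p + q))) (+-mono-≤-< p≤x q<y)

-- Every position of an opposed pair other than 0 opposite 0 holds a +1 of `v` or of `w`; a -1
-- always faces a +1, so it is already counted.
opposed-room : ∀ {v w : Vec Trit n} → Pointwise Opposed v w → Has p e v → Has q s w → p + q < n →
  ∃[ i ] lookup v i ≡ nil × Pointwise Opposed (v [ i ]≔ pos) w
opposed-room (nn ∷ vw) _ _ _ = zero , refl , pn ∷ vw
opposed-room (np ∷ vw) (nil hv) (pos {p = q} hw) lt
  with i , eq , vw′ ← opposed-room vw hv hw (s≤s⁻¹ (≤-trans (s≤s (≤-reflexive (sym (+-suc _ q)))) lt))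
  = suc i , eq , np ∷ vw′
opposed-room (pn ∷ vw) (pos hv) (nil hw) lt
  with i , eq , vw′ ← opposed-room vw hv hw (s≤s⁻¹ lt)
  = suc i , eq , pn ∷ vw′
opposed-room (pm ∷ vw) (pos hv) (neg hw) lt
  with i , eq , vw′ ← opposed-room vw hv hw (s≤s⁻¹ lt)
  = suc i , eq , pm ∷ vw′
opposed-room (mp ∷ vw) (neg hv) (pos {p = q} hw) lt
  with i , eq , vw′ ← opposed-room vw hv hw (s≤s⁻¹ (≤-trans (s≤s (≤-reflexive (sym (+-suc _ q)))) lt))
  = suc i , eq , mp ∷ vw′

against-self : ∀ {v : Vec Trit n} → Has 0 e v → Pointwise Against v v
against-self []      = []
against-self (neg h) = mm ∷ against-self h
against-self (nil h) = nn ∷ against-self h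

-- A vector without +1 is `Against` itself, through `nn` and `mm`. This settles size 0 in the
-- inductions below.
self-cross-empty : (F : Family n) → Cross F F → Typed 0 e F → # F ≡ 0
self-cross-empty F h t = #-empty F λ x → h x x (against-self (t x))

against⇒opposed : ∀ {v w : Vec Trit n} → Has p 0 v → Pointwise Against v w → Pointwise Opposed v w
against⇒opposed []      []        = []
against⇒opposed (nil h) (nn ∷ vw) = nn ∷ against⇒opposed h vw
against⇒opposed (nil h) (np ∷ vw) = np ∷ against⇒opposed h vw
against⇒opposed (pos h) (pn ∷ vw) = pn ∷ against⇒opposed h vw
against⇒opposed (pos h) (pm ∷ vw) = pm ∷ against⇒opposed h vw

-- The three entries that `w` may have opposite the single -1 of `v`. A +1 there makes the pair
-- opposed; for a 0, raising that entry of `w` to +1 does so, and for a -1, raising that entry of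
-- `v`.
Resolution : Vec Trit n → Vec Trit n → Set
Resolution v w = Pointwise Opposed v w
  ⊎ (∃[ i ] lookup w i ≡ nil × Pointwise Opposed v (w [ i ]≔ pos))
  ⊎ (∃[ i ] lookup v i ≡ neg × Pointwise Opposed (v [ i ]≔ pos) w)

resolve-tail : ∀ {a b} {v w : Vec Trit n} → Opposed a b → Resolution v w → Resolution (a ∷ v) (b ∷ w)
resolve-tail ab (inj₁ vw)                   = inj₁ (ab ∷ vw)
resolve-tail ab (inj₂ (inj₁ (i , eq , vw))) = inj₂ (inj₁ (suc i , eq , ab ∷ vw))
resolve-tail ab (inj₂ (inj₂ (i , eq , vw))) = inj₂ (inj₂ (suc i , eq , ab ∷ vw))

resolve : ∀ {v w : Vec Trit n} → Pointwise Against v w → Has p 1 v → Resolution v w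
resolve (mn ∷ vw) (neg h) = inj₂ (inj₁ (zero , refl , mp ∷ against⇒opposed h vw))
resolve (mm ∷ vw) (neg h) = inj₂ (inj₂ (zero , refl , pm ∷ against⇒opposed h vw))
resolve (mp ∷ vw) (neg h) = inj₁ (mp ∷ against⇒opposed h vw)
resolve (nn ∷ vw) (nil h) = resolve-tail nn (resolve vw h)
resolve (np ∷ vw) (nil h) = resolve-tail np (resolve vw h)
resolve (pn ∷ vw) (pos h) = resolve-tail pn (resolve vw h)
resolve (pm ∷ vw) (pos h) = resolve-tail pm (resolve vw h)

opposed⇒against : ∀ {a b} → Opposed a b → Against a b
opposed⇒against nn = nn
opposed⇒against np = np
opposed⇒against pn = pn
opposed⇒against pm = pm
opposed⇒against mp = mp

opposed-sym : ∀ {a b} → Opposed a b → Opposed b a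
opposed-sym nn = nn
opposed-sym np = pn
opposed-sym pn = np
opposed-sym pm = mp
opposed-sym mp = pm

-- binom r s is the binomial coefficient (r + s) C r, in a form symmetric in r and s.
binom : ℕ → ℕ → ℕ
binom zero    s       = 1
binom (suc r) zero    = 1
binom (suc r) (suc s) = binom r (suc s) + binom (suc r) s

binom-zeroʳ : ∀ r → binom r 0 ≡ 1
binom-zeroʳ zero    = refl
binom-zeroʳ (suc r) = refl

binom-sym : ∀ r s → binom r s ≡ binom s r
binom-sym zero    s       = sym (binom-zeroʳ s)
binom-sym (suc r) zero    = refl
binom-sym (suc r) (suc s) =
  trans (+-comm (binom r (suc s)) (binom (suc r) s)) (cong₂ _+_ (binom-sym (suc r) s) (binom-sym r (suc s)))

-- The absorption identity. It follows by induction from Pascal's rule, `dual` being the known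
-- identity with the roles of `r` and `s` exchanged.
binom-absorb : ∀ r s → suc r * binom (suc r) s ≡ suc (r + s) * binom r s
binom-absorb r zero rewrite binom-zeroʳ r | +-identityʳ r = refl
binom-absorb r (suc s) = begin
  suc r * (binom r (suc s) + binom (suc r) s)             ≡⟨ *-distribˡ-+ (suc r) (binom r (suc s)) _ ⟩
  suc r * binom r (suc s) + suc r * binom (suc r) s       ≡⟨ cong (suc r * binom r (suc s) +_) (binom-absorb r s) ⟩
  suc r * binom r (suc s) + suc (r + s) * binom r s       ≡⟨ cong (suc r * binom r (suc s) +_) dual ⟨
  suc r * binom r (suc s) + suc s * binom r (suc s)       ≡⟨ *-distribʳ-+ (binom r (suc s)) (suc r) (suc s) ⟨
  suc (r + suc s) * binom r (suc s)                       ∎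
  where
  open ≡-Reasoning
  dual : suc s * binom r (suc s) ≡ suc (r + s) * binom r s
  dual = trans (cong (suc s *_) (binom-sym r (suc s)))
        (trans (binom-absorb s r) (cong₂ _*_ (cong suc (+-comm s r)) (binom-sym s r)))

#-sets : (F : Family (suc n)) → Typed p 0 F → # F ≡ # (slice nil F) + # (slice pos F)
#-sets F t = cong (λ x → x + # (slice nil F) + # (slice pos F)) (no-neg F t)

-- Linear inequalities between family sizes, by induction on the dimension.

module _ where
  open ≤-Reasoning

  -- Since the sizes add up to `n`, disjoint means complementary: the complements of the sets in `X`
  -- are `r`-sets outside `B`. The induction pairs the +1 slice of one family with the 0 slice of
  -- the other and ends in Pascal's rule.
  sets-bound : ∀ r s → n ≡ r + s → (B X : Family n) → Typed r 0 B → Typed s 0 X → Cross X B →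
    # B + # X ≤ binom r s
  sets-bound {n = zero} zero zero refl B X _ _ h with B [] in eq | X [] in eq′
  ... | false | false = z≤n
  ... | false | true  = ≤-refl
  ... | true  | false = ≤-refl
  ... | true  | true  = ⊥-elim (h (subst T (sym eq′) tt) (subst T (sym eq) tt) [])
  sets-bound {n = suc n} r s eq B X tB tX h = begin
    # B + # X                    ≡⟨ cong₂ _+_ (#-sets B tB) (#-sets X tX) ⟩
    b₀ + b₊ + (x₀ + x₊)          ≡⟨ regroup b₀ b₊ x₀ x₊ ⟩
    (b₊ + x₀) + (b₀ + x₊)        ≤⟨ bound r s eq tB tX ⟩
    binom r s                    ∎
    where
    b₀ = # (slice nil B)
    b₊ = # (slice pos B)
    x₀ = # (slice nil X)
    x₊ = # (slice pos X)
    regroup : ∀ b₀ b₊ x₀ x₊ → b₀ + b₊ + (x₀ + x₊) ≡ (b₊ + x₀) + (b₀ + x₊)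
    regroup = solve-∀
    bound : ∀ r s → suc n ≡ r + s → Typed r 0 B → Typed s 0 X → (b₊ + x₀) + (b₀ + x₊) ≤ binom r s
    bound zero (suc s) refl tB tX =
      +-mono-≤ (≤-reflexive (cong₂ _+_ (no-pos B tB) (no-large-sets (slice nil X) (typed-nil tX) ≤-refl)))
               (sets-bound zero s refl (slice nil B) (slice pos X) (typed-nil tB) (typed-pos tX) (avoid-slice pn h))
    bound (suc r) zero eq tB tX = begin
      (b₊ + x₀) + (b₀ + x₊)   ≡⟨ cong ((b₊ + x₀) +_) (cong₂ _+_ (no-large-sets (slice nil B) (typed-nil tB) n<1+r) (no-pos X tX)) ⟩
      (b₊ + x₀) + 0           ≡⟨ +-identityʳ (b₊ + x₀) ⟩
      b₊ + x₀                 ≤⟨ sets-bound r 0 (suc-injective eq) (slice pos B) (slice nil X) (typed-pos tB) (typed-nil tX) (avoid-slice np h) ⟩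
      binom r 0               ≡⟨ binom-zeroʳ r ⟩
      1                       ∎
      where
      n<1+r = ≤-reflexive (trans eq (+-identityʳ (suc r)))
    bound (suc r) (suc s) refl tB tX =
      +-mono-≤ (sets-bound r (suc s) refl (slice pos B) (slice nil X) (typed-pos tB) (typed-nil tX) (avoid-slice np h))
               (sets-bound (suc r) s (+-suc r s) (slice nil B) (slice pos X) (typed-nil tB) (typed-pos tX) (avoid-slice pn h))

  -- An `r`-set is the set of +1's of exactly `s` vectors. If one of these is in `B`, the complement
  -- of the `r`-set cannot be in `X`.
  signed-sets-bound : ∀ r s → n ≡ r + s → (B X : Family n) → Typed r 1 B → Typed s 0 X → Cross X B →
    # B + s * # X ≤ s * binom r s
  signed-sets-bound r zero eq B X tB tX h with refl ← trans eq (+-identityʳ r) =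
    ≤-reflexive (trans (+-identityʳ (# B)) (no-full-support B tB))
  signed-sets-bound {n = zero} r (suc s) eq = ⊥-elim (0≢1+n (trans eq (+-suc r s)))
  signed-sets-bound {n = suc n} r (suc s) eq B X tB tX h = begin
    # B + suc s * # X                                            ≡⟨ cong (λ x → # B + suc s * x) (#-sets X tX) ⟩
    b₋ + b₀ + b₊ + suc s * (x₀ + x₊)                             ≡⟨ regroup s b₋ b₀ b₊ x₀ x₊ ⟩
    (b₀ + s * x₊) + (b₋ + x₊) + (b₊ + suc s * x₀)                ≤⟨ bound r eq tB ⟩
    suc s * binom r (suc s)                                      ∎
    where
    b₋ = # (slice neg B)
    b₀ = # (slice nil B)
    b₊ = # (slice pos B)
    x₀ = # (slice nil X)
    x₊ = # (slice pos X)
    regroup : ∀ s b₋ b₀ b₊ x₀ x₊ →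
      b₋ + b₀ + b₊ + suc s * (x₀ + x₊) ≡ (b₀ + s * x₊) + (b₋ + x₊) + (b₊ + suc s * x₀)
    regroup = solve-∀
    both : ∀ r → n ≡ r + s → Typed r 1 B →
      (b₀ + s * x₊) + (b₋ + x₊) ≤ s * binom r s + binom r s
    both r eq tB = +-mono-≤
      (signed-sets-bound r s eq (slice nil B) (slice pos X) (typed-nil tB) (typed-pos tX) (avoid-slice pn h))
      (sets-bound r s eq (slice neg B) (slice pos X) (typed-neg tB) (typed-pos tX) (avoid-slice pm h))
    bound : ∀ r → suc n ≡ r + suc s → Typed r 1 B →
      (b₀ + s * x₊) + (b₋ + x₊) + (b₊ + suc s * x₀) ≤ suc s * binom r (suc s)
    bound zero refl tB = ≤-trans
      (+-mono-≤ (both zero refl tB) (≤-reflexive (cong₂ (λ b x → b + suc s * x) (no-pos B tB)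
        (no-large-sets (slice nil X) (typed-nil tX) ≤-refl))))
      (≤-reflexive (total s))
      where
      total : ∀ s → s * 1 + 1 + suc s * 0 ≡ suc s * 1
      total = solve-∀
    bound (suc r) refl tB = ≤-trans
      (+-mono-≤ (both (suc r) (+-suc r s) tB)
        (signed-sets-bound r (suc s) refl (slice pos B) (slice nil X) (typed-pos tB) (typed-nil tX) (avoid-slice np h)))
      (≤-reflexive (total s (binom (suc r) s) (binom r (suc s))))
      where
      total : ∀ s x y → s * x + x + suc s * y ≡ suc s * (y + x)
      total = solve-∀

  -- Two vectors with complementary sets of +1's are always opposed, because each -1 falls on a +1
  -- of the other. So for each `r`-set either `F` has at most `s` vectors on it, or `G` has at most
  -- `r` on its complement; both cases weigh at most `r * s`.
  signed-pair-bound : ∀ r s → n ≡ r + s → (F G : Family n) → Typed r 1 F → Typed s 1 G →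
    Avoid Opposed F G → r * # F + s * # G ≤ r * s * binom r s
  signed-pair-bound zero s refl F G tF tG h =
    ≤-reflexive (trans (cong (s *_) (no-full-support G tG)) (*-zeroʳ s))
  signed-pair-bound (suc r) zero eq F G tF tG h with refl ← trans eq (+-identityʳ (suc r)) =
    ≤-trans (≤-reflexive (trans (cong (λ x → suc r * x + 0) (no-full-support F tF))
      (trans (+-identityʳ (suc r * 0)) (*-zeroʳ (suc r))))) z≤n
  signed-pair-bound {n = suc n} (suc r) (suc s) refl F G tF tG h = begin
    -- One unit of the weights of `f₊` and `g₊` is set aside for the pairs with `g₋` and `f₋`, whose
    -- vectors have lost their only -1.
    suc r * # F + suc s * # G                                                        ≡⟨ regroup r s f₋ f₀ f₊ g₋ g₀ g₊ ⟩
    (r * f₊ + suc s * g₀) + (suc r * f₀ + s * g₊) + (f₊ + suc s * g₋) + (g₊ + suc r * f₋)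
      ≤⟨ +-mono-≤ (+-mono-≤ (+-mono-≤
           (signed-pair-bound r (suc s) refl (slice pos F) (slice nil G)
             (typed-pos tF) (typed-nil tG) (avoid-slice pn h))
           (signed-pair-bound (suc r) s (+-suc r s) (slice nil F) (slice pos G)
             (typed-nil tF) (typed-pos tG) (avoid-slice np h)))
           (signed-sets-bound r (suc s) refl (slice pos F) (slice neg G) (typed-pos tF) (typed-neg tG)
             λ x y xy → h y x (pm ∷ Pointwise.sym opposed-sym (against⇒opposed (typed-neg tG x) xy))))
           (signed-sets-bound s (suc r) (trans (+-comm r (suc s)) (sym (+-suc s r))) (slice pos G) (slice neg F) (typed-pos tG) (typed-neg tF)
             λ x y xy → h x y (mp ∷ against⇒opposed (typed-neg tF x) xy)) ⟩
    r * suc s * y + suc r * s * x + suc s * y + suc r * binom s (suc r)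
      ≡⟨ cong (λ z → r * suc s * y + suc r * s * x + suc s * y + suc r * z) (binom-sym s (suc r)) ⟩
    r * suc s * y + suc r * s * x + suc s * y + suc r * x                            ≡⟨ total r s x y ⟩
    suc r * suc s * binom (suc r) (suc s)                                            ∎
    where
    f₋ = # (slice neg F)
    f₀ = # (slice nil F)
    f₊ = # (slice pos F)
    g₋ = # (slice neg G)
    g₀ = # (slice nil G)
    g₊ = # (slice pos G)
    x = binom (suc r) s
    y = binom r (suc s)
    regroup : ∀ r s f₋ f₀ f₊ g₋ g₀ g₊ →
      suc r * (f₋ + f₀ + f₊) + suc s * (g₋ + g₀ + g₊) ≡
      (r * f₊ + suc s * g₀) + (suc r * f₀ + s * g₊) + (f₊ + suc s * g₋) + (g₊ + suc r * f₋)
    regroup = solve-∀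
    total : ∀ r s x y →
      r * suc s * y + suc r * s * x + suc s * y + suc r * x ≡ suc r * suc s * (y + x)
    total = solve-∀

  -- For r = s the sizes are complementary. Above that, the two +1 slices and the two 0 slices again
  -- have sizes differing by one, and `cross-pos` keeps the +1 slices cross-intersecting.
  adjacent-sets-bound : ∀ r s → r ≤ s → n ≡ suc r + s → (A B : Family n) → Shifted B →
    Typed r 0 A → Typed (suc r) 0 B → Cross A B → Cross B B →
    # B + # A ≤ binom r (suc s)
  adjacent-sets-bound r s r≤s eq A B sh tA tB hA hB with m≤n⇒m<n∨m≡n r≤s
  ... | inj₂ refl = ≤-trans (sets-bound (suc r) r eq B A tB tA hA) (≤-reflexive (binom-sym (suc r) r))
  adjacent-sets-bound {n = suc n} r (suc s) _ refl A B sh tA tB hA hB | inj₁ (s≤s r≤s) = begin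
    # B + # A                    ≡⟨ cong₂ _+_ (#-sets B tB) (#-sets A tA) ⟩
    b₀ + b₊ + (a₀ + a₊)          ≡⟨ regroup b₀ b₊ a₀ a₊ ⟩
    (b₊ + a₊) + (b₀ + a₀)        ≤⟨ bound r r≤s refl tA tB ⟩
    binom r (suc (suc s))        ∎
    where
    b₀ = # (slice nil B)
    b₊ = # (slice pos B)
    a₀ = # (slice nil A)
    a₊ = # (slice pos A)
    regroup : ∀ b₀ b₊ a₀ a₊ → b₀ + b₊ + (a₀ + a₊) ≡ (b₊ + a₊) + (b₀ + a₀)
    regroup = solve-∀
    rest : ∀ r → r ≤ s → n ≡ r + suc s → Typed r 0 A → Typed (suc r) 0 B → b₀ + a₀ ≤ binom r (suc s)
    rest r r≤s eq tA tB = adjacent-sets-bound r s r≤s (trans eq (+-suc r s)) (slice nil A) (slice nil B)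
      (shifted-slice nil sh) (typed-nil tA) (typed-nil tB) (avoid-slice nn hA) (avoid-slice nn hB)
    bound : ∀ r → r ≤ s → n ≡ r + suc s → Typed r 0 A → Typed (suc r) 0 B →
      (b₊ + a₊) + (b₀ + a₀) ≤ binom r (suc (suc s))
    -- Here `B` consists of singletons; its +1 slice could contain only the empty set, which is
    -- disjoint from itself.
    bound zero r≤s eq tA tB = +-mono-≤
      (≤-reflexive (cong₂ _+_
        (self-cross-empty (slice pos B)
          (cross-pos B B sh hB (typed-pos tB) (typed-pos tB) (subst (0 <_) (sym eq) (s≤s z≤n))) (typed-pos tB))
        (no-pos A tA)))
      (rest zero r≤s eq tA tB)
    bound (suc r) r≤s eq tA tB = +-mono-≤
      (adjacent-sets-bound r (suc s) (≤-trans (n≤1+n r) (m≤n⇒m≤1+n r≤s)) eq (slice pos A) (slice pos B)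
        (shifted-slice pos sh) (typed-pos tA) (typed-pos tB)
        (cross-pos A B sh hA (typed-pos tA) (typed-pos tB) (room₀ (n≤1+n r) (s≤s r≤s) eq))
        (cross-pos B B sh hB (typed-pos tB) (typed-pos tB) (room₀ (≤-refl {suc r}) (s≤s r≤s) eq)))
      (rest (suc r) r≤s eq tA tB)

  -- For r = t the weights coincide and the sizes are complementary. In the step, the weights left
  -- over after two recursive calls are those of `b₀ + a₊`, sets of sizes differing by one.
  nested-sets-bound : ∀ r t → r ≤ t → n ≡ r + t → (A B : Family n) → Shifted B →
    (∀ {v} → T (B v) → T (A v)) → Typed r 0 A → Cross A B →
    t * # B + r * # A ≤ r * binom r t
  nested-sets-bound zero t _ eq A B sh B⊆A tA h = ≤-reflexive
    (trans (+-identityʳ (t * # B))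
    (trans (cong (t *_) (self-cross-empty B (h ∘ B⊆A) (tA ∘ B⊆A))) (*-zeroʳ t)))
  nested-sets-bound (suc r) t r≤t eq A B sh B⊆A tA h with m≤n⇒m<n∨m≡n r≤t
  ... | inj₂ refl = begin
    suc r * # B + suc r * # A      ≡⟨ *-distribˡ-+ (suc r) (# B) (# A) ⟨
    suc r * (# B + # A)            ≤⟨ *-monoʳ-≤ (suc r) (sets-bound (suc r) (suc r) eq B A (tA ∘ B⊆A) tA h) ⟩
    suc r * binom (suc r) (suc r)  ∎
  nested-sets-bound {n = suc n} (suc r) (suc t) _ refl A B sh B⊆A tA h | inj₁ (s≤s r<t) = begin
    suc t * # B + suc r * # A                                        ≡⟨ cong₂ (λ b a → suc t * b + suc r * a) (#-sets B tB) (#-sets A tA) ⟩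
    suc t * (b₀ + b₊) + suc r * (a₀ + a₊)                            ≡⟨ regroup r t b₀ b₊ a₀ a₊ ⟩
    (t * b₀ + suc r * a₀) + (suc t * b₊ + r * a₊) + (b₀ + a₊)
      ≤⟨ +-mono-≤ (+-mono-≤
           (nested-sets-bound (suc r) t r<t (+-suc r t) (slice nil A) (slice nil B) (shifted-slice nil sh)
             B⊆A (typed-nil tA) (avoid-slice nn h))
           (nested-sets-bound r (suc t) (m≤n⇒m≤1+n (<⇒≤ r<t)) refl (slice pos A) (slice pos B) (shifted-slice pos sh)
             B⊆A (typed-pos tA) (cross-pos A B sh h (typed-pos tA) (typed-pos tB) (room₀ ≤-refl (m≤n⇒m≤1+n r<t) refl))))
           (adjacent-sets-bound r t (<⇒≤ r<t) (+-suc r t) (slice pos A) (slice nil B) (shifted-slice nil sh)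
             (typed-pos tA) (typed-nil tB) (avoid-slice pn h) (avoid-slice nn (h ∘ B⊆A))) ⟩
    suc r * x + r * y + y                                            ≡⟨ total r x y ⟩
    suc r * binom (suc r) (suc t)                                    ∎
    where
    tB : Typed (suc r) 0 B
    tB = tA ∘ B⊆A
    b₀ = # (slice nil B)
    b₊ = # (slice pos B)
    a₀ = # (slice nil A)
    a₊ = # (slice pos A)
    x = binom (suc r) t
    y = binom r (suc t)
    regroup : ∀ r t b₀ b₊ a₀ a₊ → suc t * (b₀ + b₊) + suc r * (a₀ + a₊) ≡
      (t * b₀ + suc r * a₀) + (suc t * b₊ + r * a₊) + (b₀ + a₊)
    regroup = solve-∀
    total : ∀ r x y → suc r * x + r * y + y ≡ suc r * (y + x)
    total = solve-∀

  -- The Erdős-Ko-Rado bound: `nested-sets-bound` with both families equal, rewritten by absorption.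
  intersecting-sets-bound : ∀ r t → suc r ≤ t → n ≡ suc r + t → (F : Family n) → Shifted F →
    Typed (suc r) 0 F → Cross F F → # F ≤ binom r t
  intersecting-sets-bound r t r<t eq F sh tF h = *-cancelˡ-≤ (suc (r + t)) (begin
    suc (r + t) * # F            ≡⟨ regroup r t (# F) ⟩
    t * # F + suc r * # F        ≤⟨ nested-sets-bound (suc r) t r<t eq F F sh id tF h ⟩
    suc r * binom (suc r) t      ≡⟨ binom-absorb r t ⟩
    suc (r + t) * binom r t      ∎)
    where
    regroup : ∀ r t x → suc (r + t) * x ≡ t * x + suc r * x
    regroup = solve-∀

  -- For r = t this is `signed-sets-bound`. In the step `b₋ + x₊` is left over; the constructor `mm`
  -- of `Against` makes the sets in `slice neg B` pairwise intersecting, as `adjacent-sets-bound`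
  -- demands.
  signed-cross-bound : ∀ r t → r ≤ t → n ≡ r + t → (B X : Family n) → Shifted B →
    Typed r 1 B → Typed r 0 X → Cross B B → Cross X B →
    # B + r * # X ≤ r * binom r t
  signed-cross-bound zero t _ eq B X sh tB tX hB hX =
    ≤-reflexive (trans (+-identityʳ (# B)) (self-cross-empty B hB tB))
  signed-cross-bound (suc r) t r≤t eq B X sh tB tX hB hX with m≤n⇒m<n∨m≡n r≤t
  ... | inj₂ refl = signed-sets-bound (suc r) (suc r) eq B X tB tX hX
  signed-cross-bound {n = suc n} (suc r) (suc t) _ refl B X sh tB tX hB hX | inj₁ (s≤s r<t) = begin
    # B + suc r * # X                                        ≡⟨ cong (λ x → # B + suc r * x) (#-sets X tX) ⟩
    b₋ + b₀ + b₊ + suc r * (x₀ + x₊)                         ≡⟨ regroup r b₋ b₀ b₊ x₀ x₊ ⟩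
    (b₀ + suc r * x₀) + (b₊ + r * x₊) + (b₋ + x₊)
      ≤⟨ +-mono-≤ (+-mono-≤
           (signed-cross-bound (suc r) t r<t (+-suc r t) (slice nil B) (slice nil X) (shifted-slice nil sh)
             (typed-nil tB) (typed-nil tX) (avoid-slice nn hB) (avoid-slice nn hX))
           (signed-cross-bound r (suc t) (m≤n⇒m≤1+n (<⇒≤ r<t)) refl (slice pos B) (slice pos X) (shifted-slice pos sh)
             (typed-pos tB) (typed-pos tX)
             (cross-pos B B sh hB (typed-pos tB) (typed-pos tB) (room₁ (≤-refl {r}) (s≤s r<t) refl))
             (cross-pos X B sh hX (typed-pos tX) (typed-pos tB) (room₀ (≤-refl {r}) (m≤n⇒m≤1+n r<t) refl))))
           (adjacent-sets-bound r t (<⇒≤ r<t) (+-suc r t) (slice pos X) (slice neg B) (shifted-slice neg sh)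
             (typed-pos tX) (typed-neg tB) (avoid-slice pm hX) (avoid-slice mm hB)) ⟩
    suc r * x + r * y + y                                    ≡⟨ total r x y ⟩
    suc r * binom (suc r) (suc t)                            ∎
    where
    b₋ = # (slice neg B)
    b₀ = # (slice nil B)
    b₊ = # (slice pos B)
    x₀ = # (slice nil X)
    x₊ = # (slice pos X)
    x = binom (suc r) t
    y = binom r (suc t)
    regroup : ∀ r b₋ b₀ b₊ x₀ x₊ → b₋ + b₀ + b₊ + suc r * (x₀ + x₊) ≡
      (b₀ + suc r * x₀) + (b₊ + r * x₊) + (b₋ + x₊)
    regroup = solve-∀
    total : ∀ r x y → suc r * x + r * y + y ≡ suc r * (y + x)
    total = solve-∀

  -- The weights are those for which the case r = t is a multiple of `signed-sets-bound`: there the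
  -- sizes `r` and `suc r` are complementary.
  covered-bound : ∀ r t → r ≤ t → n ≡ suc r + t → (A B : Family n) → Shifted B → Covers A B →
    Typed (suc r) 0 A → Typed r 1 B → Cross A B → Cross B B →
    suc r * r * # A + t * # B ≤ r * suc r * binom (suc r) t
  covered-bound zero t _ eq A B sh cov tA tB hA hB =
    ≤-reflexive (trans (cong (t *_) (self-cross-empty B hB tB)) (*-zeroʳ t))
  covered-bound (suc r) t r≤t eq A B sh cov tA tB hA hB with m≤n⇒m<n∨m≡n r≤t
  ... | inj₂ refl = begin
    suc (suc r) * suc r * # A + suc r * # B
      ≡⟨ regroup r (# A) (# B) ⟩
    suc r * (# B + suc (suc r) * # A)
      ≤⟨ *-monoʳ-≤ (suc r) (signed-sets-bound (suc r) (suc (suc r)) (trans eq (+-comm (suc (suc r)) (suc r))) B A tB tA hA) ⟩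
    suc r * (suc (suc r) * binom (suc r) (suc (suc r)))
      ≡⟨ *-assoc (suc r) (suc (suc r)) (binom (suc r) (suc (suc r))) ⟨
    suc r * suc (suc r) * binom (suc r) (suc (suc r))
      ≡⟨ cong (suc r * suc (suc r) *_) (binom-sym (suc r) (suc (suc r))) ⟩
    suc r * suc (suc r) * binom (suc (suc r)) (suc r) ∎
    where
    regroup : ∀ r a b → suc (suc r) * suc r * a + suc r * b ≡ suc r * (b + suc (suc r) * a)
    regroup = solve-∀
  covered-bound {n = suc n} (suc r) (suc t) _ refl A B sh cov tA tB hA hB | inj₁ (s≤s r<t) = begin
    suc (suc r) * suc r * # A + suc t * # B
      ≡⟨ cong (λ a → suc (suc r) * suc r * a + suc t * # B) (#-sets A tA) ⟩
    suc (suc r) * suc r * (a₀ + a₊) + suc t * (b₋ + b₀ + b₊)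
      ≡⟨ regroup r t a₀ a₊ b₋ b₀ b₊ ⟩
    -- The surplus weight of `a₊` is twice the size of its sets. One half is used with `b₋`, which
    -- `Covers` places inside `slice pos A`, the other with `b₀`.
    (suc (suc r) * suc r * a₀ + t * b₀) + (suc r * r * a₊ + suc t * b₊) +
    (suc t * b₋ + suc r * a₊) + (b₀ + suc r * a₊)
      ≤⟨ +-mono-≤ (+-mono-≤ (+-mono-≤
           (covered-bound (suc r) t r<t (+-suc (suc r) t) (slice nil A) (slice nil B) (shifted-slice nil sh)
             (λ i → cov (suc i)) (typed-nil tA) (typed-nil tB) (avoid-slice nn hA) (avoid-slice nn hB))
           (covered-bound r (suc t) (m≤n⇒m≤1+n (<⇒≤ r<t)) refl (slice pos A) (slice pos B) (shifted-slice pos sh)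
             (λ i → cov (suc i)) (typed-pos tA) (typed-pos tB)
             (cross-pos A B sh hA (typed-pos tA) (typed-pos tB) (room₀ (≤-refl {suc r}) (m≤n⇒m≤1+n r<t) refl))
             (cross-pos B B sh hB (typed-pos tB) (typed-pos tB) (room₁ (n≤1+n r) (s≤s r<t) refl))))
           (nested-sets-bound (suc r) (suc t) (m≤n⇒m≤1+n r<t) refl (slice pos A) (slice neg B) (shifted-slice neg sh)
             (λ x → cov zero x refl) (typed-pos tA) (avoid-slice pm hA)))
           (signed-cross-bound (suc r) (suc t) (m≤n⇒m≤1+n r<t) refl (slice nil B) (slice pos A) (shifted-slice nil sh)
             (typed-nil tB) (typed-pos tA) (avoid-slice nn hB) (avoid-slice pn hA)) ⟩
    suc r * suc (suc r) * x + r * suc r * y + suc r * y + suc r * y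
      ≡⟨ total r x y ⟩
    suc r * suc (suc r) * binom (suc (suc r)) (suc t) ∎
    where
    a₀ = # (slice nil A)
    a₊ = # (slice pos A)
    b₋ = # (slice neg B)
    b₀ = # (slice nil B)
    b₊ = # (slice pos B)
    x = binom (suc (suc r)) t
    y = binom (suc r) (suc t)
    regroup : ∀ r t a₀ a₊ b₋ b₀ b₊ →
      suc (suc r) * suc r * (a₀ + a₊) + suc t * (b₋ + b₀ + b₊) ≡
      (suc (suc r) * suc r * a₀ + t * b₀) + (suc r * r * a₊ + suc t * b₊) +
      (suc t * b₋ + suc r * a₊) + (b₀ + suc r * a₊)
    regroup = solve-∀
    total : ∀ r x y → suc r * suc (suc r) * x + r * suc r * y + suc r * y + suc r * y ≡
      suc r * suc (suc r) * (y + x)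
    total = solve-∀

  -- `signed-pair-bound` with both families equal, using C(2k, k) = 2 C(2k - 1, k). It starts the
  -- two inductions that follow.
  balanced-bound : ∀ t → n ≡ suc t + suc t → (F : Family n) → Typed (suc t) 1 F →
    Avoid Opposed F F → # F ≤ suc t * binom (suc t) t
  balanced-bound t eq F tF h = *-cancelˡ-≤ (2 * suc t) (begin
    2 * suc t * # F                                   ≡⟨ regroup t (# F) ⟩
    suc t * # F + suc t * # F                         ≤⟨ signed-pair-bound (suc t) (suc t) eq F F tF tF h ⟩
    suc t * suc t * (binom t (suc t) + binom (suc t) t)
      ≡⟨ cong (λ x → suc t * suc t * (x + binom (suc t) t)) (binom-sym t (suc t)) ⟩
    suc t * suc t * (binom (suc t) t + binom (suc t) t) ≡⟨ total t (binom (suc t) t) ⟩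
    2 * suc t * (suc t * binom (suc t) t)             ∎)
    where
    regroup : ∀ t x → 2 * suc t * x ≡ suc t * x + suc t * x
    regroup = solve-∀
    total : ∀ t x → suc t * suc t * (x + x) ≡ 2 * suc t * (suc t * x)
    total = solve-∀

  -- When n = 2r, avoiding `Opposed` alone suffices. Otherwise the 0 and +1 slices are of the same
  -- kind, and the -1 slice is an intersecting family of sets, bounded by Erdős-Ko-Rado.
  self-cross-bound : ∀ r t → r ≤ suc t → n ≡ r + suc t → (B : Family n) → Shifted B →
    Typed r 1 B → Cross B B → # B ≤ r * binom r t
  self-cross-bound zero t _ eq B sh tB h = ≤-reflexive (self-cross-empty B h tB)
  self-cross-bound (suc r) t r≤t eq B sh tB h with m≤n⇒m<n∨m≡n r≤t
  ... | inj₂ refl = balanced-bound t eq B tB λ x y xy → h x y (Pointwise.map opposed⇒against xy)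
  self-cross-bound {n = suc n} (suc r) (suc t) _ refl B sh tB h | inj₁ (s≤s (s≤s r≤t)) = begin
    b₋ + b₀ + b₊               ≡⟨ regroup b₋ b₀ b₊ ⟩
    b₀ + b₊ + b₋
      ≤⟨ +-mono-≤ (+-mono-≤
           (self-cross-bound (suc r) t (s≤s r≤t) (+-suc r (suc t)) (slice nil B) (shifted-slice nil sh)
             (typed-nil tB) (avoid-slice nn h))
           (self-cross-bound r (suc t) (m≤n⇒m≤1+n (m≤n⇒m≤1+n r≤t)) refl (slice pos B) (shifted-slice pos sh)
             (typed-pos tB)
             (cross-pos B B sh h (typed-pos tB) (typed-pos tB) (room₁ (≤-refl {r}) (s≤s (s≤s r≤t)) refl))))
           (intersecting-sets-bound r (suc t) (s≤s r≤t) (+-suc r (suc t)) (slice neg B) (shifted-slice neg sh)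
             (typed-neg tB) (avoid-slice mm h)) ⟩
    suc r * x + r * y + y      ≡⟨ total r x y ⟩
    suc r * (y + x)            ∎
    where
    b₋ = # (slice neg B)
    b₀ = # (slice nil B)
    b₊ = # (slice pos B)
    x = binom (suc r) t
    y = binom r (suc t)
    regroup : ∀ b₋ b₀ b₊ → b₋ + b₀ + b₊ ≡ b₀ + b₊ + b₋
    regroup = solve-∀
    total : ∀ r x y → suc r * x + r * y + y ≡ suc r * (y + x)
    total = solve-∀

  -- Here k = r + 1 and n = k + t + 1, so `r ≤ t` says 2k ≤ n. Passing to the 0 slice keeps k and
  -- lowers `t`, until n = 2k.
  opposed-free-bound : ∀ r t → r ≤ t → n ≡ suc r + suc t → t ≤ r * suc r →
    (F : Family n) → Shifted F → Typed (suc r) 1 F → Avoid Opposed F F →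
    # F ≤ suc r * binom (suc r) t
  opposed-free-bound r t r≤t eq t≤ F sh tF h with m≤n⇒m<n∨m≡n r≤t
  ... | inj₂ refl = balanced-bound t eq F tF h
  opposed-free-bound {n = suc n} r (suc t) _ refl t≤ F sh tF h | inj₁ (s≤s r≤t) = begin
    a + f₀ + b                        ≡⟨ regroup a f₀ b ⟩
    (a + b) + f₀
      ≤⟨ +-mono-≤ outer
           (opposed-free-bound r t r≤t (+-suc r (suc t)) (<⇒≤ t≤) (slice nil F) (shifted-slice nil sh)
             (typed-nil tF) (avoid-slice nn h)) ⟩
    suc r * c + suc r * binom (suc r) t   ≡⟨ *-distribˡ-+ (suc r) c (binom (suc r) t) ⟨
    suc r * (c + binom (suc r) t)     ∎
    where
    A = slice neg F
    B = slice pos F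
    a = # A
    b = # B
    f₀ = # (slice nil F)
    c = binom r (suc t)
    -- The difference of the weights of `a` and `b` in `covered`. The hypothesis `t≤` keeps the
    -- subtraction from being truncated.
    d = r * suc r ∸ suc t
    t+d≡ : suc t + d ≡ r * suc r
    t+d≡ = m+[n∸m]≡n t≤
    regroup : ∀ a f b → a + f + b ≡ (a + b) + f
    regroup = solve-∀

    raise : ∀ {z} v i → lookup v i ≡ z → T (B v) → compare pos z ≡ desc → T (F (z ∷ v [ i ]≔ pos))
    raise v i refl x eq = sh (first i) eq x

    self-cross : Cross B B
    self-cross {v} {w} x y vw with resolve vw (typed-pos tF x)
    -- Two leading +1's do not oppose each other, so that of `v` is exchanged with a common 0;
    -- `r ≤ t` leaves room for one. In the other two cases the exchange is made at the -1 of `v`.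
    ... | inj₁ o
          with i , eq , o′ ← opposed-room o (typed-pos tF x) (typed-pos tF y) (+-monoʳ-< r (s≤s (m≤n⇒m≤1+n r≤t)))
          = h (raise v i eq x refl) y (np ∷ o′)
    ... | inj₂ (inj₁ (i , eq , o)) = h x (raise w i eq y refl) (pn ∷ o)
    ... | inj₂ (inj₂ (i , eq , o)) = h (raise v i eq x refl) y (mp ∷ o)

    covered : suc r * r * a + suc t * b ≤ r * suc r * binom (suc r) (suc t)
    covered = covered-bound r (suc t) (m≤n⇒m≤1+n r≤t) (+-suc r (suc t)) A B (shifted-slice pos sh)
      (λ i {v} x eq → raise v i eq x refl) (typed-neg tF) (typed-pos tF)
      (λ x y xy → h x y (mp ∷ against⇒opposed (typed-neg tF x) xy)) self-cross

    weighted : suc t * (a + b) + d * a ≤ suc t * (suc r * c) + d * c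
    weighted = begin
      suc t * (a + b) + d * a           ≡⟨ left (suc t) d a b ⟩
      (suc t + d) * a + suc t * b       ≡⟨ cong (λ x → x * a + suc t * b) (trans t+d≡ (*-comm r (suc r))) ⟩
      suc r * r * a + suc t * b         ≤⟨ covered ⟩
      r * suc r * binom (suc r) (suc t) ≡⟨ *-assoc r (suc r) (binom (suc r) (suc t)) ⟩
      r * (suc r * binom (suc r) (suc t)) ≡⟨ cong (r *_) (binom-absorb r (suc t)) ⟩
      r * (suc (r + suc t) * c)         ≡⟨ middle r t c ⟩
      r * suc r * c + suc t * (r * c)   ≡⟨ cong (λ x → x * c + suc t * (r * c)) t+d≡ ⟨
      (suc t + d) * c + suc t * (r * c) ≡⟨ right r t d c ⟩
      suc t * (suc r * c) + d * c       ∎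
      where
      left : ∀ t d a b → t * (a + b) + d * a ≡ (t + d) * a + t * b
      left = solve-∀
      middle : ∀ r t c → r * (suc (r + suc t) * c) ≡ r * suc r * c + suc t * (r * c)
      middle = solve-∀
      right : ∀ r t d c → (suc t + d) * c + suc t * (r * c) ≡ suc t * (suc r * c) + d * c
      right = solve-∀

    outer : a + b ≤ suc r * c
    outer with ≤-total a c
    ... | inj₁ a≤c = +-mono-≤ a≤c (self-cross-bound r (suc t) (m≤n⇒m≤1+n (m≤n⇒m≤1+n r≤t)) refl B
                       (shifted-slice pos sh) (typed-pos tF) self-cross)
    ... | inj₂ c≤a = *-cancelˡ-≤ (suc t) (+-cancelʳ-≤ (d * a) _ _
                       (≤-trans weighted (+-monoʳ-≤ (suc t * (suc r * c)) (*-monoʳ-≤ d c≤a))))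

-- From families to lists of integer vectors

encode : Trit → ℤ
encode neg = -1ℤ
encode nil = 0ℤ
encode pos = 1ℤ

encodes : Vec Trit n → Vec ℤ n
encodes = Vec.map encode

encode-injective : ∀ {a b} → encode a ≡ encode b → a ≡ b
encode-injective {neg} {neg} _ = refl
encode-injective {nil} {nil} _ = refl
encode-injective {pos} {pos} _ = refl

encodes-injective : ∀ {v w : Vec Trit n} → encodes v ≡ encodes w → v ≡ w
encodes-injective {v = []}    {[]}    _  = refl
encodes-injective {v = a ∷ v} {b ∷ w} eq =
  cong₂ _∷_ (encode-injective (Vec.∷-injectiveˡ eq)) (encodes-injective (Vec.∷-injectiveʳ eq))

has-count : (v : Vec Trit n) → Has (count (ℤ._≟ 1ℤ) (encodes v)) (count (ℤ._≟ -1ℤ) (encodes v)) v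
has-count []        = []
has-count (neg ∷ v) = neg (has-count v)
has-count (nil ∷ v) = nil (has-count v)
has-count (pos ∷ v) = pos (has-count v)

count-pos : ∀ {v : Vec Trit n} → Has p e v → count (ℤ._≟ 1ℤ) (encodes v) ≡ p
count-pos []      = refl
count-pos (neg h) = count-pos h
count-pos (nil h) = count-pos h
count-pos (pos h) = cong suc (count-pos h)

count-neg : ∀ {v : Vec Trit n} → Has p e v → count (ℤ._≟ -1ℤ) (encodes v) ≡ e
count-neg []      = refl
count-neg (neg h) = cong suc (count-neg h)
count-neg (nil h) = count-neg h
count-neg (pos h) = count-neg h

decode : {x : Vec ℤ n} → VecAll.All (λ z → z ≡ 0ℤ ⊎ z ≡ 1ℤ ⊎ z ≡ -1ℤ) x → ∃[ v ] x ≡ encodes v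
decode VecAll.[] = [] , refl
decode (z VecAll.∷ zs) with decode zs
decode (inj₁ refl        VecAll.∷ _) | v , refl = nil ∷ v , refl
decode (inj₂ (inj₁ refl) VecAll.∷ _) | v , refl = pos ∷ v , refl
decode (inj₂ (inj₂ refl) VecAll.∷ _) | v , refl = neg ∷ v , refl

encodes-coordinates : (v : Vec Trit n) →
  VecAll.All (λ z → z ≡ 0ℤ ⊎ z ≡ 1ℤ ⊎ z ≡ -1ℤ) (encodes v)
encodes-coordinates []        = VecAll.[]
encodes-coordinates (neg ∷ v) = inj₂ (inj₂ refl) VecAll.∷ encodes-coordinates v
encodes-coordinates (nil ∷ v) = inj₁ refl VecAll.∷ encodes-coordinates v
encodes-coordinates (pos ∷ v) = inj₂ (inj₁ refl) VecAll.∷ encodes-coordinates v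

opposed-product : ∀ {v w : Vec Trit n} → Pointwise Opposed v w → Has p e v → Has q s w →
  ⟨ encodes v , encodes w ⟩ ≡ ℤ.- (ℤ.+ (e + s))
opposed-product []        []       []       = refl
opposed-product (nn ∷ vw) (nil hv) (nil hw) = trans (ℤ.+-identityˡ _) (opposed-product vw hv hw)
opposed-product (np ∷ vw) (nil hv) (pos hw) = trans (ℤ.+-identityˡ _) (opposed-product vw hv hw)
opposed-product (pn ∷ vw) (pos hv) (nil hw) = trans (ℤ.+-identityˡ _) (opposed-product vw hv hw)
opposed-product (pm ∷ vw) (pos {e = e} hv) (neg {e = s} hw) =
  trans (cong (λ x → -1ℤ ℤ.+ x) (opposed-product vw hv hw))
 (trans (sym (ℤ.neg-distrib-+ 1ℤ (ℤ.+ (e + s)))) (cong (λ x → ℤ.- (ℤ.+ x)) (sym (+-suc e s))))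
opposed-product (mp ∷ vw) (neg {e = e} hv) (pos {e = s} hw) =
  trans (cong (λ x → -1ℤ ℤ.+ x) (opposed-product vw hv hw)) (sym (ℤ.neg-distrib-+ 1ℤ (ℤ.+ (e + s))))

product-step : ∀ c {m} {x y : ℤ} → ℤ.- (ℤ.+ c) ℤ.≤ x → ℤ.- (ℤ.+ m) ℤ.≤ y → ℤ.- (ℤ.+ (c + m)) ℤ.≤ x ℤ.+ y
product-step c {m} c≤x m≤y =
  ℤ.≤-trans (ℤ.≤-reflexive (ℤ.neg-distrib-+ (ℤ.+ c) (ℤ.+ m))) (ℤ.+-mono-≤ c≤x m≤y)

-- Each coordinate with product -1 uses up a -1 of `v` or of `w`.
product-bound : ∀ {v w : Vec Trit n} → Has p e v → Has q s w →
  ℤ.- (ℤ.+ (e + s)) ℤ.≤ ⟨ encodes v , encodes w ⟩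
product-bound []       []       = ℤ.≤-refl
product-bound (neg {e = e} hv) (neg {e = s} hw) rewrite +-suc e s = product-step 2 ℤ.-≤+ (product-bound hv hw)
product-bound (neg hv) (nil hw) = product-step 1 ℤ.-≤+ (product-bound hv hw)
product-bound (neg hv) (pos hw) = product-step 1 ℤ.≤-refl (product-bound hv hw)
product-bound {e = e} (nil hv) (neg {e = s} hw) rewrite +-suc e s = product-step 1 ℤ.-≤+ (product-bound hv hw)
product-bound (nil hv) (nil hw) = product-step 0 ℤ.≤-refl (product-bound hv hw)
product-bound (nil hv) (pos hw) = product-step 0 ℤ.≤-refl (product-bound hv hw)
product-bound {e = e} (pos hv) (neg {e = s} hw) rewrite +-suc e s = product-step 1 ℤ.≤-refl (product-bound hv hw)
product-bound (pos hv) (nil hw) = product-step 0 ℤ.≤-refl (product-bound hv hw)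
product-bound (pos hv) (pos hw) = product-step 0 (ℤ.+≤+ z≤n) (product-bound hv hw)

_∈?_ : (x : Vec ℤ n) (L : List (Vec ℤ n)) → Dec (x ∈ L)
_∈?_ = DecMembership._∈?_ (Vec.≡-dec ℤ._≟_)

-- By `Unique`, the head is new to the family of the tail, so adding it raises the count strictly.
length≤# : (L : List (Vec ℤ n)) → Unique L → All (λ x → ∃[ v ] x ≡ encodes v) L →
  length L ≤ # (λ v → isYes (encodes v ∈? L))
length≤# []      _        _                 = z≤n
length≤# {n} (_ ∷ L) (v∉L ∷ u) ((v , refl) ∷ h) = ≤-<-trans (length≤# L u h)
  (∑-mono-< _ _ (λ w → grows w (encodes w ∈? L) (encodes w ∈? (encodes v ∷ L))) v
    (new (encodes v ∈? L) (encodes v ∈? (encodes v ∷ L))))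
  where
  grows : ∀ w (d : Dec (encodes w ∈ L)) (d′ : Dec (encodes w ∈ (encodes v ∷ L))) →
    weigh (isYes d) 1 ≤ weigh (isYes d′) 1
  grows w (no _)  d′       = z≤n
  grows w (yes _) (yes _)  = ≤-refl
  grows w (yes m) (no ¬m)  = ⊥-elim (¬m (there m))
  new : ∀ (d : Dec (encodes v ∈ L)) (d′ : Dec (encodes v ∈ (encodes v ∷ L))) →
    weigh (isYes d) 1 < weigh (isYes d′) 1
  new (yes m) _        = ⊥-elim (All¬⇒¬Any v∉L m)
  new (no _)  (yes _)  = ≤-refl
  new (no _)  (no ¬m)  = ⊥-elim (¬m (here refl))

-- Listing and counting families, for the extremal example.

elements : Family n → List (Vec Trit n)
elements {zero}  F = if F [] then [] ∷ [] else []
elements {suc n} F =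
  (List.map (neg ∷_) (elements (slice neg F)) ++ List.map (nil ∷_) (elements (slice nil F))) ++
  List.map (pos ∷_) (elements (slice pos F))

length-elements : (F : Family n) → length (elements F) ≡ # F
length-elements {zero}  F with F []
... | true  = refl
... | false = refl
length-elements {suc n} F =
  trans (length-++ (on neg ++ on nil))
        (cong₂ _+_ (trans (length-++ (on neg)) (cong₂ _+_ (len neg) (len nil))) (len pos))
  where
  on : Trit → List (Vec Trit (suc n))
  on a = List.map (a ∷_) (elements (slice a F))
  len : ∀ a → length (on a) ≡ # (slice a F)
  len a = trans (length-map (a ∷_) (elements (slice a F))) (length-elements (slice a F))

elements-unique : (F : Family n) → Unique (elements F)
elements-unique {zero}  F with F []
... | true  = [] ∷ []
... | false = []
elements-unique {suc n} F =
  Unique.++⁺ (Unique.++⁺ (on neg) (on nil) neg∥nil) (on pos) rest∥pos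
  where
  L : Trit → List (Vec Trit (suc n))
  L a = List.map (a ∷_) (elements (slice a F))
  on : ∀ a → Unique (L a)
  on a = Unique.map⁺ Vec.∷-injectiveʳ (elements-unique (slice a F))
  head≡ : ∀ {a v} → v ∈ L a → Vec.head v ≡ a
  head≡ {a} m with _ , _ , refl ← ∈-map⁻ (a ∷_) m = refl
  neg∥nil : Disjoint (L neg) (L nil)
  neg∥nil (m , m′) with () ← trans (sym (head≡ m)) (head≡ m′)
  rest∥pos : Disjoint (L neg ++ L nil) (L pos)
  rest∥pos (m , m′) with ∈-++⁻ (L neg) m
  ... | inj₁ m with () ← trans (sym (head≡ m)) (head≡ m′)
  ... | inj₂ m with () ← trans (sym (head≡ m)) (head≡ m′)

elements-all : (F : Family n) → All (T ∘ F) (elements F)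
elements-all {zero}  F with F [] in eq
... | true  = subst T (sym eq) tt ∷ []
... | false = []
elements-all {suc n} F = All.++⁺ (All.++⁺ (on neg) (on nil)) (on pos)
  where
  on : ∀ a → All (T ∘ F) (List.map (a ∷_) (elements (slice a F)))
  on a = All.map⁺ (elements-all (slice a F))

-- The recursion follows the entries, so that each nonempty slice is definitionally another such
-- family and the counts obey Pascal's rule.
vectors : ℕ → ℕ → Family n
vectors p       e       []        = (p ≡ᵇ 0) ∧ (e ≡ᵇ 0)
vectors p       zero    (neg ∷ v) = false
vectors p       (suc e) (neg ∷ v) = vectors p e v
vectors p       e       (nil ∷ v) = vectors p e v
vectors zero    e       (pos ∷ v) = false
vectors (suc p) e       (pos ∷ v) = vectors p e v

vectors-typed : ∀ p e → Typed {n} p e (vectors p e)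
vectors-typed zero    zero    {[]}      _ = []
vectors-typed p       (suc e) {neg ∷ v} x = neg (vectors-typed p e x)
vectors-typed p       zero    {nil ∷ v} x = nil (vectors-typed p zero x)
vectors-typed p       (suc e) {nil ∷ v} x = nil (vectors-typed p (suc e) x)
vectors-typed (suc p) zero    {pos ∷ v} x = pos (vectors-typed p zero x)
vectors-typed (suc p) (suc e) {pos ∷ v} x = pos (vectors-typed p (suc e) x)

#-vectors₀ : ∀ r s → n ≡ r + s → # {n} (vectors r 0) ≡ binom r s
#-vectors₀ {zero} zero zero refl = refl
#-vectors₀ {suc n} r s eq = trans (#-sets (vectors {suc n} r 0) (vectors-typed r 0)) (go r s eq)
  where
  go : ∀ r s → suc n ≡ r + s → # {n} (vectors r 0) + # (slice pos (vectors {suc n} r 0)) ≡ binom r s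
  go zero (suc s) refl = cong₂ _+_ (#-vectors₀ zero s refl) (no-pos (vectors {suc n} 0 0) (vectors-typed 0 0))
  go (suc r) zero eq = trans
    (cong₂ _+_ (no-large-sets (vectors {n} (suc r) 0) (vectors-typed (suc r) 0)
                 (≤-reflexive (trans eq (+-identityʳ (suc r)))))
               (#-vectors₀ r 0 (suc-injective eq)))
    (binom-zeroʳ r)
  go (suc r) (suc s) refl = trans
    (cong₂ _+_ (#-vectors₀ (suc r) s (+-suc r s)) (#-vectors₀ r (suc s) refl))
    (+-comm (binom (suc r) s) (binom r (suc s)))

#-vectors₁ : ∀ r s → n ≡ r + s → # {n} (vectors r 1) ≡ s * binom r s
#-vectors₁ r zero eq with refl ← trans eq (+-identityʳ r) = no-full-support (vectors r 1) (vectors-typed r 1)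
#-vectors₁ {suc n} zero (suc s) refl = trans
  (cong₂ _+_ (cong₂ _+_ (#-vectors₀ 0 s refl) (#-vectors₁ 0 s refl)) (no-pos (vectors {suc n} 0 1) (vectors-typed 0 1)))
  (+-identityʳ (suc (s * 1)))
#-vectors₁ {suc n} (suc r) (suc s) refl = trans
  (cong₂ _+_ (cong₂ _+_ (#-vectors₀ (suc r) s (+-suc r s)) (#-vectors₁ (suc r) s (+-suc r s)))
             (#-vectors₁ r (suc s) refl))
  (total s (binom (suc r) s) (binom r (suc s)))
  where
  total : ∀ s x y → x + s * x + suc s * y ≡ suc s * (y + x)
  total = solve-∀

binom≡C : ∀ r s → binom r s ≡ (r + s) C r
binom≡C zero    s       = sym (trans (nCk≡nC[n∸k] {0} {s} z≤n) (nCn≡1 s))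
binom≡C (suc r) zero    = sym (trans (cong (_C suc r) (+-identityʳ (suc r))) (nCn≡1 (suc r)))
binom≡C (suc r) (suc s) = trans
  (cong₂ _+_ (binom≡C r (suc s)) (trans (binom≡C (suc r) s) (cong (_C suc r) (sym (+-suc r s)))))
  (nCk+nC[k+1]≡[n+1]C[k+1] (r + suc s) r)

-- The two bounds for lists of integer vectors, and the theorem.

upper-bound : ∀ r t → r ≤ t → n ≡ suc r + suc t → t ≤ r * suc r → (L : List (Vec ℤ n)) →
  IsIntersectingFamily n (suc r) L → length L ≤ suc r * binom (suc r) t
upper-bound {n} r t r≤t eq t≤ L int = finish (shifting P closed {F} ((λ {v} → typed {v}) , (λ {v} {w} → avoid {v} {w})))
  where
  members = IsIntersectingFamily.members int
  F : Family n
  F v = isYes (encodes v ∈? L)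
  typed : Typed (suc r) 1 F
  typed {v} x = subst₂ (λ p e → Has p e v) (𝒱₁.plusOnes m) (𝒱₁.minusOnes m) (has-count v)
    where m = All.lookup members (toWitness x)
  avoid : Avoid Opposed F F
  -- With one -1 in each vector, an opposed pair has product exactly -2.
  avoid {v} {w} x y vw = ℤ.<-irrefl (sym (opposed-product vw (typed {v} x) (typed {w} y)))
    (IsIntersectingFamily.intersecting int (toWitness x) (toWitness y))
  P : Family n → Set
  P G = Typed (suc r) 1 G × Avoid Opposed G G
  closed : ∀ π {G} → P G → P (shift π G)
  closed π {G} (tG , hG) = (λ {v} → typed-shift π {G} tG {v}) , (λ {v} {w} → avoid-shift π {G} hG {v} {w})
  finish : (∃[ G ] P G × Shifted G × # F ≤ # G) → length L ≤ suc r * binom (suc r) t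
  finish (G , (tG , hG) , shG , F≤G) =
    ≤-trans (length≤# L (IsIntersectingFamily.distinct int) (All.map (decode ∘ 𝒱₁.coordinates) members))
   (≤-trans F≤G (opposed-free-bound r t r≤t eq t≤ G shG tG hG))

attained : ∀ r t → ∃[ L ] IsIntersectingFamily (suc (r + suc t)) (suc r) L ×
  length L ≡ suc r * binom (suc r) t
attained r t = L , record { distinct = distinct ; members = members ; intersecting = intersecting } , size
  where
  F : Family (r + suc t)
  F = vectors r 1
  lift : Vec Trit (r + suc t) → Vec ℤ (suc (r + suc t))
  lift v = encodes (pos ∷ v)
  L = List.map lift (elements F)
  distinct : Unique L
  distinct = Unique.map⁺ (λ {v} {w} eq → Vec.∷-injectiveʳ (encodes-injective {v = pos ∷ v} {pos ∷ w} eq)) (elements-unique F)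
  member : ∀ {v} → T (F v) → 𝒱₁ (suc (r + suc t)) (suc r) (lift v)
  member {v} x = record
    { coordinates = encodes-coordinates (pos ∷ v)
    ; plusOnes    = count-pos (pos (vectors-typed r 1 {v} x))
    ; minusOnes   = count-neg (pos (vectors-typed r 1 {v} x)) }
  members : All (𝒱₁ (suc (r + suc t)) (suc r)) L
  members = All.map⁺ (All.map (λ {v} → member {v}) (elements-all F))
  intersecting : ∀ {x y} → x ∈ L → y ∈ L → ⟨ x , y ⟩ ℤ.> -[1+ 1 ]
  -- The common leading +1 contributes 1 and the other coordinates at least -2, so the product is at
  -- least -1.
  intersecting x∈ y∈ with v , v∈ , refl ← ∈-map⁻ lift x∈ | w , w∈ , refl ← ∈-map⁻ lift y∈ =
    ℤ.<-≤-trans (ℤ.-<- ≤-refl) (ℤ.+-monoʳ-≤ 1ℤ (product-bound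
      (vectors-typed r 1 {v} (All.lookup (elements-all F) v∈)) (vectors-typed r 1 {w} (All.lookup (elements-all F) w∈))))
  size : length L ≡ suc r * binom (suc r) t
  size = begin
    length L                   ≡⟨ length-map lift (elements F) ⟩
    length (elements F)        ≡⟨ length-elements F ⟩
    # F                        ≡⟨ #-vectors₁ r (suc t) refl ⟩
    -- Absorption is applied twice: both this and the goal equal `suc (r + t) * binom r t`.
    suc t * binom r (suc t)    ≡⟨ cong (suc t *_) (binom-sym r (suc t)) ⟩
    suc t * binom (suc t) r    ≡⟨ binom-absorb t r ⟩
    suc (t + r) * binom t r    ≡⟨ cong₂ _*_ (cong suc (+-comm t r)) (binom-sym t r) ⟩
    suc (r + t) * binom r t    ≡⟨ binom-absorb r t ⟨
    suc r * binom (suc r) t    ∎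
    where open ≡-Reasoning

theorem2 : ∀ (n k : ℕ) → 2 ≤ k → 2 * k ≤ n → n ≤ k ^ 2 →
    m[ n , k ,1]≡ (k * ((n ∸ 1) C k))
theorem2 n (suc r) 2≤k 2k≤n n≤k² = go (n ∸ suc (suc r)) (sym (m+[n∸m]≡n (≤-trans 2+r≤2k 2k≤n)))
  where
  double : ∀ r → 2 * suc r ≡ suc (suc r) + r
  double = solve-∀
  square : ∀ r → suc r * (suc r * 1) ≡ suc r + r * suc r
  square = solve-∀
  2+r≤2k : suc (suc r) ≤ 2 * suc r
  2+r≤2k = ≤-trans (m≤m+n (suc (suc r)) r) (≤-reflexive (sym (double r)))
  go : ∀ t → n ≡ suc (suc r) + t → m[ n , suc r ,1]≡ (suc r * ((n ∸ 1) C suc r))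
  go t refl = subst (m[ suc (suc r) + t , suc r ,1]≡_) (cong (suc r *_) (binom≡C (suc r) t))
    ( subst (λ m → ∃[ L ] IsIntersectingFamily m (suc r) L × length L ≡ suc r * binom (suc r) t)
        (cong suc (+-suc r t)) (attained r t)
    , λ { _ (L , int , refl) → upper-bound r t r≤t (sym (cong suc (+-suc r t))) t≤ L int })
    where
    r≤t : r ≤ t
    r≤t = +-cancelˡ-≤ (suc (suc r)) r t (subst (_≤ suc (suc r) + t) (double r) 2k≤n)
    t≤ : t ≤ r * suc r
    -- Cancelling `suc r` in n ≤ k² would give `suc t ≤ r * suc r`; `n≤1+n` brings this to the form
    -- that `upper-bound` takes.
    t≤ = +-cancelˡ-≤ (suc r) t (r * suc r) (≤-trans (n≤1+n (suc r + t)) (subst (suc (suc r) + t ≤_) (square r) n≤k²))
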